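{- Let $r$ be an odd positive integer, $n=4r$, and $BL_r=2^{2r}+2^r+1$. Then $BL_r$ is invertible modulo $2^n-1$ and $$BL_r^{ -1}\equiv\sum_{i=0}^{r-1}\sum_{j=0}^{3}a_{i,j}2^{i-jr}\pmod{2^n-1},$$ where $(a_{i,j})$ is the $r\times4$ matrix with row $0$ equal to $(1,1,1,0)$, row $i$ equal to $(0,0,0,0)$ for odd $i$, and row $i$ equal to $(1,1,1,1)$ for even $i$ with $2\le i\le r-1$. Moreover $\mathrm{wt}(BL_r^{ -1})=\frac{n+2}{2}$.
   Context: $BL_r^{ -1}$ denotes the least positive residue of the inverse of $BL_r$ modulo $2^n-1$, and $\mathrm{wt}(m)$ is the number of ones in the binary expansion of $m$. Powers $2^{m}$ with arbitrary integer $m$ are understood modulo $2^n-1$, i.e. $2^m=2^{m\bmod n}$. -}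

module Defs where

open import Data.Nat using (ℕ; zero; suc; _+_; _*_; _∸_; _^_; _<_)
open import Data.Nat.DivMod using (_%_; _/_)
open import Data.List using (List; map; upTo)
open import Data.Nat.ListAction using (sum)

-- Hamming weight: number of ones in the binary expansion of m.
-- (fuel-based; m bits suffice since each step halves m)
wtAux : ℕ → ℕ → ℕ
wtAux zero    m = 0
wtAux (suc k) m = m % 2 + wtAux k (m / 2)

wt : ℕ → ℕ
wt m = wtAux m m

BL : ℕ → ℕ
BL r = 2 ^ (2 * r) + 2 ^ r + 1

isEven : ℕ → ℕ
isEven i = 1 ∸ (i % 2)

a : ℕ → ℕ → ℕ
a zero 0 = 1
a zero 1 = 1
a zero 2 = 1
a zero _ = 0
a (suc i) j = isEven (suc i)

-- 2^{i - j r} understood modulo 2^n - 1 (n = 4r), i.e. 2^{(i - j r) mod n};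
-- for 0 ≤ j ≤ 3 we compute (i - j r) mod n as (i + (4 - j) r) mod n.
pow2 : ℕ → ℕ → ℕ → ℕ
pow2 r i j = 2 ^ ((i + (4 ∸ j) * r) % suc (4 * r ∸ 1))  -- suc (4r-1) = 4r = n for r ≥ 1

BLinvSum : ℕ → ℕ
BLinvSum r = sum (map (λ i → sum (map (λ j → a i j * pow2 r i j) (upTo 4))) (upTo r))

-- modulus 2^n - 1 with n = 4r, written as suc (2^n - 2) so that % has a NonZero instance
-- (equal to 2^n - 1 since 2^n ≥ 2 for r ≥ 1)
modulus : ℕ → ℕ
modulus r = suc (2 ^ (4 * r) ∸ 2)

module Submission where

-- Put r = 2k + 1, y = 2^r and t = ones₄ k = (4^k − 1)/3, so that y = 2 + 6t.  Reading the
-- exponents i − jr modulo 4r, row i of the matrix contributes 2^i (a_{i0} + a_{i1} y³ + a_{i2} y²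
-- + a_{i3} y), and the even rows 2, 4, …, 2k together carry the factor 4t.  Hence the sum is
-- x = 1 + y² + y³ + 4t(1 + y + y² + y³), whose base-y digits are 1 + 4t, 4t, 1 + 4t, 1 + 4t.
-- Once y = 2 + 6t is substituted, BL·x ≡ 1 and x < y⁴ − 1 are polynomial identities in t, and
-- the weight adds up over the base-2^r digits: (k + 1) + k + (k + 1) + (k + 1) = 2r + 1.

open import Defs
open import Data.Nat
open import Data.Nat.Properties
open import Data.Nat.DivMod
open import Data.Nat.Divisibility using (n∣m*n)
open import Data.Nat.ListAction using (sum)
open import Data.Nat.ListAction.Properties using (sum-++)
open import Data.Nat.Tactic.RingSolver using (solve-∀)
open import Data.List using (map; upTo; [_]; _++_)
open import Data.List.Properties using (map-++; upTo-∷ʳ)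
open import Data.Product using (Σ-syntax; _×_; _,_)
open import Function using (_∘_)
open import Relation.Binary.PropositionalEquality using (_≡_; refl; sym; trans; cong; cong₂; subst; module ≡-Reasoning)

m≤1+n⇒m/2≤n : ∀ {m n} → m ≤ suc n → m / 2 ≤ n
m≤1+n⇒m/2≤n {zero}  _      = z≤n
m≤1+n⇒m/2≤n {suc m} m≤1+n = ≤-pred (≤-trans (m/n<m (suc m) 2 ≤-refl) m≤1+n)

wtAux-zero : ∀ f → wtAux f 0 ≡ 0
wtAux-zero zero    = refl
wtAux-zero (suc f) = wtAux-zero f

wtAux-fuel : ∀ {f g m} → m ≤ f → m ≤ g → wtAux f m ≡ wtAux g m
wtAux-fuel {zero}  {g}     z≤n _   = sym (wtAux-zero g)
wtAux-fuel {suc f} {zero}  _   z≤n = wtAux-zero (suc f)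
wtAux-fuel {suc f} {suc g} {m} m≤f m≤g =
  cong (m % 2 +_) (wtAux-fuel (m≤1+n⇒m/2≤n m≤f) (m≤1+n⇒m/2≤n m≤g))

wt-step : ∀ m → wt m ≡ m % 2 + wt (m / 2)
wt-step zero    = refl
wt-step (suc m) = cong (suc m % 2 +_) (wtAux-fuel {m} {suc m / 2} (m≤1+n⇒m/2≤n ≤-refl) ≤-refl)

wt-bit : ∀ c q → c < 2 → wt (c + q * 2) ≡ c + wt q
wt-bit c q c<2 = begin
  wt (c + q * 2)                            ≡⟨ wt-step (c + q * 2) ⟩
  (c + q * 2) % 2 + wt ((c + q * 2) / 2)   ≡⟨ cong₂ (λ u v → u + wt v) low high ⟩
  c + wt q                                  ∎
  where
  open ≡-Reasoning
  low : (c + q * 2) % 2 ≡ c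
  low = trans ([m+kn]%n≡m%n c q 2) (m<n⇒m%n≡m c<2)
  high : (c + q * 2) / 2 ≡ q
  high = trans (+-distrib-/-∣ʳ c (n∣m*n q)) (cong₂ _+_ (m<n⇒m/n≡0 c<2) (m*n/n≡m q 2))

wt-+-2^* : ∀ e {a} b → a < 2 ^ e → wt (a + 2 ^ e * b) ≡ wt a + wt b
wt-+-2^* zero    {zero}  b _           = cong wt (+-identityʳ b)
wt-+-2^* zero    {suc _} b (s≤s ())
wt-+-2^* (suc e) {a}     b a<2^[1+e] = begin
  wt (a + 2 ^ suc e * b)                   ≡⟨ cong wt split ⟩
  wt (a % 2 + (a / 2 + 2 ^ e * b) * 2)     ≡⟨ wt-bit (a % 2) (a / 2 + 2 ^ e * b) (m%n<n a 2) ⟩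
  a % 2 + wt (a / 2 + 2 ^ e * b)           ≡⟨ cong (a % 2 +_) (wt-+-2^* e b a/2<2^e) ⟩
  a % 2 + (wt (a / 2) + wt b)              ≡⟨ +-assoc (a % 2) _ _ ⟨
  a % 2 + wt (a / 2) + wt b                ≡⟨ cong (_+ wt b) (wt-step a) ⟨
  wt a + wt b                              ∎
  where
  open ≡-Reasoning
  a/2<2^e : a / 2 < 2 ^ e
  a/2<2^e = m<n*o⇒m/o<n (subst (a <_) (*-comm 2 (2 ^ e)) a<2^[1+e])
  regroup : ∀ c q p b → c + q * 2 + 2 * p * b ≡ c + (q + p * b) * 2
  regroup = solve-∀
  split : a + 2 ^ suc e * b ≡ a % 2 + (a / 2 + 2 ^ e * b) * 2
  split = trans (cong (_+ 2 ^ suc e * b) (m≡m%n+[m/n]*n a 2)) (regroup (a % 2) (a / 2) (2 ^ e) b)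

ones₄ : ℕ → ℕ
ones₄ zero    = 0
ones₄ (suc k) = 1 + 4 * ones₄ k

wt-ones₄ : ∀ k → wt (ones₄ k) ≡ k
wt-ones₄ zero    = refl
wt-ones₄ (suc k) = trans (wt-+-2^* 2 (ones₄ k) (s≤s (s≤s z≤n))) (cong suc (wt-ones₄ k))

wt-4*ones₄ : ∀ k → wt (4 * ones₄ k) ≡ k
wt-4*ones₄ k = trans (wt-+-2^* 2 (ones₄ k) (s≤s z≤n)) (wt-ones₄ k)

2^[1+2k]≡2+6*ones₄ : ∀ k → 2 ^ suc (k * 2) ≡ 2 + 6 * ones₄ k
2^[1+2k]≡2+6*ones₄ zero    = refl
2^[1+2k]≡2+6*ones₄ (suc k) =
  trans (cong (λ z → 2 * (2 * z)) (2^[1+2k]≡2+6*ones₄ k)) (step (ones₄ k))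
  where
  step : ∀ x → 2 * (2 * (2 + 6 * x)) ≡ 2 + 6 * (1 + 4 * x)
  step = solve-∀

4*ones₄-suc : ∀ k → 4 * ones₄ (suc k) ≡ 4 * ones₄ k + 2 ^ suc (suc (k * 2))
4*ones₄-suc zero    = refl
4*ones₄-suc (suc k) =
  trans (cong (λ z → 4 * (1 + z)) (4*ones₄-suc k)) (step (ones₄ k) (2 ^ suc (suc (k * 2))))
  where
  step : ∀ x p → 4 * (1 + (4 * x + p)) ≡ 4 * (1 + 4 * x) + 2 * (2 * p)
  step = solve-∀

2^[n*r]≡[2^r]^n : ∀ n r → 2 ^ (n * r) ≡ (2 ^ r) ^ n
2^[n*r]≡[2^r]^n n r = trans (cong (2 ^_) (*-comm n r)) (sym (^-*-assoc 2 r n))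

row : ℕ → ℕ → ℕ
row r i = sum (map (λ j → a i j * pow2 r i j) (upTo 4))

-- Modulo y⁴ − 1 with y = 2^r, the power 2^{i − jr} is 2^i · y^{4 − j}.
rowPoly : ℕ → ℕ → ℕ
rowPoly y i = a i 0 + a i 1 * (y * y * y) + a i 2 * (y * y) + a i 3 * y

pow2-wrap : ∀ {r i} → i < suc r → pow2 (suc r) i 0 ≡ 2 ^ i
pow2-wrap {r} {i} i<r = cong (2 ^_) (trans ([m+n]%n≡m%n i (4 * suc r)) (m<n⇒m%n≡m i<4r))
  where
  i<4r : i < 4 * suc r
  i<4r = ≤-trans i<r (m≤n*m (suc r) 4)

2^[i+c*r]%4r : ∀ {r i} c → i < suc r → c < 4 →
               2 ^ ((i + c * suc r) % (4 * suc r)) ≡ 2 ^ i * (2 ^ suc r) ^ c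
2^[i+c*r]%4r {r} {i} c i<r c<4 = begin
  2 ^ ((i + c * suc r) % (4 * suc r))  ≡⟨ cong (2 ^_) (m<n⇒m%n≡m i+cr<4r) ⟩
  2 ^ (i + c * suc r)                   ≡⟨ ^-distribˡ-+-* 2 i (c * suc r) ⟩
  2 ^ i * 2 ^ (c * suc r)               ≡⟨ cong (2 ^ i *_) (2^[n*r]≡[2^r]^n c (suc r)) ⟩
  2 ^ i * (2 ^ suc r) ^ c               ∎
  where
  open ≡-Reasoning
  i+cr<4r : i + c * suc r < 4 * suc r
  i+cr<4r = ≤-trans (+-monoˡ-< (c * suc r) i<r) (*-monoˡ-≤ (suc r) c<4)

row-reduce : ∀ {r i} → i < suc r → row (suc r) i ≡ 2 ^ i * rowPoly (2 ^ suc r) i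
row-reduce {r} {i} i<r = begin
  row (suc r) i
    ≡⟨ cong₂ (λ u v → a i 0 * u + (a i 1 * v + (a i 2 * P 2 + (a i 3 * P 3 + 0))))
             (pow2-wrap i<r) (2^[i+c*r]%4r 3 i<r (s≤s (s≤s (s≤s (s≤s z≤n))))) ⟩
  a i 0 * 2 ^ i + (a i 1 * (2 ^ i * y ^ 3) + (a i 2 * P 2 + (a i 3 * P 3 + 0)))
    ≡⟨ cong₂ (λ u v → a i 0 * 2 ^ i + (a i 1 * (2 ^ i * y ^ 3) + (a i 2 * u + (a i 3 * v + 0))))
             (2^[i+c*r]%4r 2 i<r (s≤s (s≤s (s≤s z≤n)))) (2^[i+c*r]%4r 1 i<r (s≤s (s≤s z≤n))) ⟩
  a i 0 * 2 ^ i + (a i 1 * (2 ^ i * y ^ 3) + (a i 2 * (2 ^ i * y ^ 2) + (a i 3 * (2 ^ i * y ^ 1) + 0)))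
    ≡⟨ factor (2 ^ i) y (a i 0) (a i 1) (a i 2) (a i 3) ⟩
  2 ^ i * rowPoly y i ∎
  where
  open ≡-Reasoning
  y = 2 ^ suc r
  P = pow2 (suc r) i
  factor : ∀ p y a₀ a₁ a₂ a₃ →
    a₀ * p + (a₁ * (p * (y * (y * (y * 1)))) + (a₂ * (p * (y * (y * 1))) + (a₃ * (p * (y * 1)) + 0)))
      ≡ p * (a₀ + a₁ * (y * y * y) + a₂ * (y * y) + a₃ * y)
  factor = solve-∀

isEven-odd : ∀ k → isEven (suc (k * 2)) ≡ 0
isEven-odd k = cong (1 ∸_) ([m+kn]%n≡m%n 1 k 2)

isEven-even : ∀ k → isEven (suc (suc (k * 2))) ≡ 1
isEven-even k = cong (1 ∸_) (m*n%n≡0 (suc k) 2)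

rowPoly-odd : ∀ y k → rowPoly y (suc (k * 2)) ≡ 0
rowPoly-odd y k = cong (λ e → e + e * (y * y * y) + e * (y * y) + e * y) (isEven-odd k)

rowPoly-even : ∀ y k → rowPoly y (suc (suc (k * 2))) ≡ 1 + y * y * y + y * y + y
rowPoly-even y k =
  trans (cong (λ e → e + e * (y * y * y) + e * (y * y) + e * y) (isEven-even k)) (ones y)
  where
  ones : ∀ y → 1 + 1 * (y * y * y) + 1 * (y * y) + 1 * y ≡ 1 + y * y * y + y * y + y
  ones = solve-∀

sum-map-upTo-suc : ∀ (f : ℕ → ℕ) n → sum (map f (upTo (suc n))) ≡ sum (map f (upTo n)) + f n
sum-map-upTo-suc f n = begin
  sum (map f (upTo (suc n)))           ≡⟨ cong (sum ∘ map f) (upTo-∷ʳ n) ⟨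
  sum (map f (upTo n ++ [ n ]))        ≡⟨ cong sum (map-++ f (upTo n) [ n ]) ⟩
  sum (map f (upTo n) ++ [ f n ])      ≡⟨ sum-++ (map f (upTo n)) [ f n ] ⟩
  sum (map f (upTo n)) + (f n + 0)     ≡⟨ cong (sum (map f (upTo n)) +_) (+-identityʳ (f n)) ⟩
  sum (map f (upTo n)) + f n           ∎
  where open ≡-Reasoning

rows : ℕ → ℕ → ℕ
rows r n = sum (map (row r) (upTo n))

rows-odd : ∀ {r} k → k * 2 < suc r →
           let y = 2 ^ suc r in
           rows (suc r) (suc (k * 2)) ≡ 1 + y * y * y + y * y + 4 * ones₄ k * (1 + y * y * y + y * y + y)
rows-odd {r} zero _ =
  trans (+-identityʳ (row (suc r) 0)) (trans (row-reduce {r} (s≤s z≤n)) (first-row (2 ^ suc r)))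
  where
  first-row : ∀ y → 1 * (1 + 1 * (y * y * y) + 1 * (y * y) + 0 * y)
                      ≡ 1 + y * y * y + y * y + 4 * 0 * (1 + y * y * y + y * y + y)
  first-row = solve-∀
rows-odd {r} (suc k) 2k+2<r = begin
  rows (suc r) (3 + k * 2)
    ≡⟨ trans (sum-map-upTo-suc (row (suc r)) (2 + k * 2))
             (cong (_+ row (suc r) (2 + k * 2)) (sum-map-upTo-suc (row (suc r)) (1 + k * 2))) ⟩
  rows (suc r) (1 + k * 2) + row (suc r) (1 + k * 2) + row (suc r) (2 + k * 2)
    ≡⟨ cong₂ _+_ (cong₂ _+_ (rows-odd k (<-trans (n<1+n _) 2k+1<r)) odd-row) even-row ⟩
  1 + y * y * y + y * y + 4 * ones₄ k * Q + 2 ^ (1 + k * 2) * 0 + 2 ^ (2 + k * 2) * Q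
    ≡⟨ collect (y * y * y) (y * y) (4 * ones₄ k) (2 ^ (1 + k * 2)) (2 ^ (2 + k * 2)) Q ⟩
  1 + y * y * y + y * y + (4 * ones₄ k + 2 ^ (2 + k * 2)) * Q
    ≡⟨ cong (λ s → 1 + y * y * y + y * y + s * Q) (4*ones₄-suc k) ⟨
  1 + y * y * y + y * y + 4 * ones₄ (suc k) * Q ∎
  where
  open ≡-Reasoning
  y = 2 ^ suc r
  Q = 1 + y * y * y + y * y + y
  2k+1<r : 1 + k * 2 < suc r
  2k+1<r = <-trans (n<1+n _) 2k+2<r
  odd-row : row (suc r) (1 + k * 2) ≡ 2 ^ (1 + k * 2) * 0
  odd-row = trans (row-reduce {r} 2k+1<r) (cong (2 ^ (1 + k * 2) *_) (rowPoly-odd y k))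
  even-row : row (suc r) (2 + k * 2) ≡ 2 ^ (2 + k * 2) * Q
  even-row = trans (row-reduce {r} 2k+2<r) (cong (2 ^ (2 + k * 2) *_) (rowPoly-even y k))
  collect : ∀ y₃ y₂ s p p′ Q → 1 + y₃ + y₂ + s * Q + p * 0 + p′ * Q ≡ 1 + y₃ + y₂ + (s + p′) * Q
  collect = solve-∀

-- For y = 2^r and t = ones₄ k this is BL_r^{-1}, written in base y.
blInv : ℕ → ℕ → ℕ
blInv y t = (1 + 4 * t) + y * (4 * t + y * ((1 + 4 * t) + y * (1 + 4 * t)))

rows-odd≡blInv : ∀ {r} k → k * 2 < suc r →
                 rows (suc r) (suc (k * 2)) ≡ blInv (2 ^ suc r) (ones₄ k)
rows-odd≡blInv {r} k 2k<r = trans (rows-odd k 2k<r) (to-digits (2 ^ suc r) (ones₄ k))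
  where
  to-digits : ∀ y t → 1 + y * y * y + y * y + 4 * t * (1 + y * y * y + y * y + y)
                        ≡ (1 + 4 * t) + y * (4 * t + y * ((1 + 4 * t) + y * (1 + 4 * t)))
  to-digits = solve-∀

-- c is the quotient (BL · x − 1) / (y⁴ − 1).
blInv-inverse : ∀ t → let y = 2 + 6 * t ; d = 1 + 4 * t ; c = 2 + (y + 2) * d in
  (y * y + y + 1) * (d + y * (4 * t + y * (d + y * d))) + c ≡ 1 + c * (y * y * y * y)
blInv-inverse = solve-∀

-- The second summand is y⁴ − 1 minus the digit form, computed digit by digit: every digit of
-- y⁴ − 1 is y − 1.
blInv-complement : ∀ t → let y = 2 + 6 * t ; d = 1 + 4 * t in
  suc (d + y * (4 * t + y * (d + y * d)) + ((1 + 2 * t) * y + 2 * t * (1 + y * y + y * y * y)))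
    ≡ y * y * y * y
blInv-complement = solve-∀

BL≡y²+y+1 : ∀ r → let y = 2 ^ r in BL r ≡ y * y + y + 1
BL≡y²+y+1 r =
  cong (λ z → z + 2 ^ r + 1) (trans (2^[n*r]≡[2^r]^n 2 r) (cong (2 ^ r *_) (*-identityʳ (2 ^ r))))

2^[4r]≡y⁴ : ∀ r → let y = 2 ^ r in 2 ^ (4 * r) ≡ y * y * y * y
2^[4r]≡y⁴ r = trans (2^[n*r]≡[2^r]^n 4 r) (fourth (2 ^ r))
  where
  fourth : ∀ y → y * (y * (y * (y * 1))) ≡ y * y * y * y
  fourth = solve-∀

2^[4r]≡1+modulus : ∀ r → 2 ^ (4 * suc r) ≡ suc (modulus (suc r))
2^[4r]≡1+modulus r = trans (sym (m∸n+n≡m 2≤2^n)) (+-comm (2 ^ n ∸ 2) 2)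
  where
  n = 4 * suc r
  2≤2^n : 2 ≤ 2 ^ n
  2≤2^n = ^-monoʳ-≤ 2 {1} {n} (s≤s z≤n)

n+c≡1+c*[1+m]⇒n≡1+c*m : ∀ n c m → n + c ≡ 1 + c * suc m → n ≡ 1 + c * m
n+c≡1+c*[1+m]⇒n≡1+c*m n c m eq = +-cancelʳ-≡ c n (1 + c * m) (begin
  n + c              ≡⟨ eq ⟩
  1 + c * suc m      ≡⟨ cong suc (*-suc c m) ⟩
  1 + (c + c * m)    ≡⟨ cong suc (+-comm c (c * m)) ⟩
  1 + c * m + c      ∎)
  where open ≡-Reasoning

[1+c*m]%m≡1 : ∀ c {m} .{{_ : NonZero m}} → 1 < m → (1 + c * m) % m ≡ 1
[1+c*m]%m≡1 c {m} 1<m = trans ([m+kn]%n≡m%n 1 c m) (m<n⇒m%n≡m 1<m)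

module _ (k : ℕ) where
  private
    r = suc (k * 2)
    t = ones₄ k
    y = 2 ^ r
    Y = 2 + 6 * t
    x = BLinvSum r

    y≡Y : y ≡ Y
    y≡Y = 2^[1+2k]≡2+6*ones₄ k

    x≡blInv : x ≡ blInv y t
    x≡blInv = rows-odd≡blInv k ≤-refl

    x≡blInvY : x ≡ blInv Y t
    x≡blInvY = trans x≡blInv (cong (λ z → blInv z t) y≡Y)

    Y⁴≡1+modulus : Y * Y * Y * Y ≡ suc (modulus r)
    Y⁴≡1+modulus = begin
      Y * Y * Y * Y      ≡⟨ cong (λ z → z * z * z * z) y≡Y ⟨
      y * y * y * y      ≡⟨ 2^[4r]≡y⁴ r ⟨
      2 ^ (4 * r)        ≡⟨ 2^[4r]≡1+modulus (k * 2) ⟩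
      suc (modulus r)    ∎
      where open ≡-Reasoning

  BLinvSum>0 : 0 < BLinvSum r
  BLinvSum>0 = subst (0 <_) (sym x≡blInv) (s≤s z≤n)

  BLinvSum<modulus : BLinvSum r < modulus r
  BLinvSum<modulus = subst (x <_) (suc-injective 1+x+s≡1+M) (m<m+n x (s≤s z≤n))
    where
    s = (1 + 2 * t) * Y + 2 * t * (1 + Y * Y + Y * Y * Y)
    1+x+s≡1+M : suc (x + s) ≡ suc (modulus r)
    1+x+s≡1+M = trans (cong (λ z → suc (z + s)) x≡blInvY) (trans (blInv-complement t) Y⁴≡1+modulus)

  BL*BLinvSum≡1 : (BL r * BLinvSum r) % modulus r ≡ 1
  BL*BLinvSum≡1 = begin
    (BL r * x) % modulus r          ≡⟨ cong (_% modulus r) BLx≡1+c*M ⟩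
    (1 + c * modulus r) % modulus r ≡⟨ [1+c*m]%m≡1 c (≤-<-trans BLinvSum>0 BLinvSum<modulus) ⟩
    1                               ∎
    where
    open ≡-Reasoning
    c = 2 + (Y + 2) * (1 + 4 * t)
    BLx≡1+c*M : BL r * x ≡ 1 + c * modulus r
    BLx≡1+c*M = n+c≡1+c*[1+m]⇒n≡1+c*m (BL r * x) c (modulus r) (begin
      BL r * x + c                         ≡⟨ cong₂ (λ b z → b * z + c) (BL≡y²+y+1 r) x≡blInvY ⟩
      (y * y + y + 1) * blInv Y t + c      ≡⟨ cong (λ z → (z * z + z + 1) * blInv Y t + c) y≡Y ⟩
      (Y * Y + Y + 1) * blInv Y t + c      ≡⟨ blInv-inverse t ⟩
      1 + c * (Y * Y * Y * Y)              ≡⟨ cong (λ z → 1 + c * z) Y⁴≡1+modulus ⟩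
      1 + c * suc (modulus r)              ∎)

  wt-BLinvSum : wt (BLinvSum r) ≡ (4 * r + 2) / 2
  wt-BLinvSum = begin
    wt x                                      ≡⟨ cong wt x≡blInv ⟩
    wt (d + y * (4 * t + y * (d + y * d)))    ≡⟨ wt-+-2^* r (4 * t + y * (d + y * d)) d<y ⟩
    wt d + wt (4 * t + y * (d + y * d))       ≡⟨ cong (wt d +_) (wt-+-2^* r (d + y * d) 4t<y) ⟩
    wt d + (wt (4 * t) + wt (d + y * d))      ≡⟨ cong (λ z → wt d + (wt (4 * t) + z)) (wt-+-2^* r d d<y) ⟩
    wt d + (wt (4 * t) + (wt d + wt d))
      ≡⟨ cong₂ (λ u v → u + (v + (u + u))) (wt-ones₄ (suc k)) (wt-4*ones₄ k) ⟩
    suc k + (k + (suc k + suc k))             ≡⟨ m*n/n≡m (suc k + (k + (suc k + suc k))) 2 ⟨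
    (suc k + (k + (suc k + suc k))) * 2 / 2   ≡⟨ cong (_/ 2) (double k) ⟩
    (4 * r + 2) / 2                           ∎
    where
    open ≡-Reasoning
    d = 1 + 4 * t
    d<Y : d < Y
    d<Y = s≤s (s≤s (*-monoˡ-≤ t {4} {6} (s≤s (s≤s (s≤s (s≤s z≤n))))))
    d<y : d < y
    d<y = subst (d <_) (sym y≡Y) d<Y
    4t<y : 4 * t < y
    4t<y = <-trans (n<1+n (4 * t)) d<y
    double : ∀ k → (suc k + (k + (suc k + suc k))) * 2 ≡ 4 * suc (k * 2) + 2
    double = solve-∀

proposition11 : (k : ℕ) →
    Σ[ x ∈ ℕ ] ((0 < x × x < modulus (2 * k + 1)
                  × (BL (2 * k + 1) * x) % modulus (2 * k + 1) ≡ 1)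
      × x % modulus (2 * k + 1) ≡ BLinvSum (2 * k + 1) % modulus (2 * k + 1)
      × wt x ≡ (4 * (2 * k + 1) + 2) / 2)
proposition11 k rewrite +-comm (2 * k) 1 | *-comm 2 k =
  BLinvSum r , (BLinvSum>0 k , BLinvSum<modulus k , BL*BLinvSum≡1 k) , refl , wt-BLinvSum k
  where
  r = suc (k * 2)
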